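{- Let $\Gamma=\langle n_1,n_2,\dots,n_m\rangle$ be a telescopic numerical semigroup with $n_1<\cdots<n_m$. Then for every $z\in\mathbb{N}$ we have $$\#\operatorname{Ap}(\Gamma,z)\geq n_1\left\lceil\frac{z}{n_m}\right\rceil;$$ hence $\mathrm E(\Gamma,2)=n_1$.
   Context: $\mathbb N$ denotes the non-negative integers. A numerical semigroup is a set $\langle n_1,\dots,n_m\rangle:=n_1\mathbb N+\cdots+n_m\mathbb N$ with $n_i$ positive integers and $\gcd(n_1,\dots,n_m)=1$. A set $A$ of positive integers is the minimal generating set of $\Gamma$ if $\Gamma=\langle A\rangle\ne\langle A\setminus\{n\}\rangle$ for every $n\in A$; its elements are the minimal generators. For $x\in\mathbb Z$, the Apéry set is $\operatorname{Ap}(\Gamma,x)=\{a\in\Gamma\mid a-x\notin\Gamma\}$. Gluing: given numerical semigroups $\Gamma_1,\Gamma_2$, $a_1\in\Gamma_2$ and $a_2\in\Gamma_1$ with $\gcd(a_1,a_2)=1$, $a_1$ not a minimal generator of $\Gamma_2$ and $a_2$ not a minimal generator of $\Gamma_1$, the numerical semigroup $a_1\Gamma_1+a_2\Gamma_2$ is called a gluing of $\Gamma_1$ and $\Gamma_2$. Telescopic (recursive definition): $\Gamma$ is telescopic if either $\Gamma=\mathbb N$, or $\Gamma=a_1\Gamma_1+a_2\mathbb N$ is a gluing of $\Gamma_1$ and $\mathbb N$ with $\Gamma_1$ telescopic and $a_2>a_1n$ for each minimal generator $n$ of $\Gamma_1$. Second Feng-Rao number: for $b\in\Gamma$ let $\mathrm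 D(b)=\{c\in\Gamma\mid b-c\in\Gamma\}$, and let $\delta^2_{FR}(a)=\min\{\#(\mathrm D(b_1)\cup \mathrm D(b_2))\mid b_1,b_2\in\Gamma,\ a\le b_1<b_2\}$. With $c$ the conductor of $\Gamma$ (least integer $c \ge 0$ such that all integers $\ge c$ lie in $\Gamma$) and $g=\#(\mathbb N\setminus\Gamma)$ the genus, $\mathrm E(\Gamma,2)$ is the constant such that $\delta^2_{FR}(a)=a+1-2g+\mathrm E(\Gamma,2)$ for all non-negative integers $a\ge 2c-1$. It is known (and may be taken as the definition) that $\mathrm E(\Gamma,2)=\min\{\#\operatorname{Ap}(\Gamma,x)\mid x\in\mathbb N\setminus\{0\}\}$. -}

module Defs where

open import Data.Integer.Base using (ℤ; +_; _-_)
open import Data.List.Base using (List; []; _∷_; foldr; filter; length)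
open import Data.List.Membership.Propositional using () renaming (_∈_ to _∈ˡ_)
open import Data.List.Relation.Unary.All using (All)
open import Data.List.Relation.Unary.Unique.Propositional using (Unique)
open import Data.Nat.Base using (ℕ; NonZero; _+_; _*_; _<_; _≤_)
open import Data.Nat.GCD using (gcd)
open import Data.Nat.Properties using (_≟_)
open import Data.Product.Base using (∃; ∃₂; _×_)
open import Function.Bundles using (_⇔_)
open import Level using (0ℓ)
open import Relation.Binary.PropositionalEquality using (_≡_; _≢_)
open import Relation.Nullary using (¬_; ¬?)
open import Relation.Unary using (Pred; _∈_; _≐_; U; ｛_｝)

infixr 6 _⊕_
infixr 7 _·_
infixl 6 _∖_
infix 4 _HasSize_

_·_ : ℕ → Pred ℕ 0ℓ → Pred ℕ 0ℓ
(a · P) x = ∃ λ y → y ∈ P × x ≡ a * y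

_⊕_ : Pred ℕ 0ℓ → Pred ℕ 0ℓ → Pred ℕ 0ℓ
(P ⊕ Q) x = ∃₂ λ y z → y ∈ P × z ∈ Q × x ≡ y + z

⟨_⟩ : List ℕ → Pred ℕ 0ℓ
⟨ ns ⟩ = foldr (λ n P → n · U ⊕ P) ｛ 0 ｝ ns

gcds : List ℕ → ℕ
gcds = foldr gcd 0

IsNumericalSemigroup : Pred ℕ 0ℓ → Set
IsNumericalSemigroup Γ =
  ∃ λ ns → All NonZero ns × gcds ns ≡ 1 × Γ ≐ ⟨ ns ⟩

_∖_ : List ℕ → ℕ → List ℕ
A ∖ n = filter (λ x → ¬? (x ≟ n)) A

-- The list A stands for the set of its entries.
record IsMinimalGeneratingSet (Γ : Pred ℕ 0ℓ) (A : List ℕ) : Set where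
  field
    positive  : All NonZero A
    generates : Γ ≐ ⟨ A ⟩
    minimal   : ∀ {n} → n ∈ˡ A → ¬ (Γ ≐ ⟨ A ∖ n ⟩)

IsMinimalGenerator : Pred ℕ 0ℓ → ℕ → Set
IsMinimalGenerator Γ n = ∃ λ A → IsMinimalGeneratingSet Γ A × n ∈ˡ A

record IsGluing (Γ : Pred ℕ 0ℓ) (a₁ : ℕ) (Γ₁ : Pred ℕ 0ℓ)
                (a₂ : ℕ) (Γ₂ : Pred ℕ 0ℓ) : Set where
  field
    numerical₁ : IsNumericalSemigroup Γ₁
    numerical₂ : IsNumericalSemigroup Γ₂
    a₁∈Γ₂      : a₁ ∈ Γ₂
    a₂∈Γ₁      : a₂ ∈ Γ₁
    coprime    : gcd a₁ a₂ ≡ 1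
    a₁-notMin  : ¬ IsMinimalGenerator Γ₂ a₁
    a₂-notMin  : ¬ IsMinimalGenerator Γ₁ a₂
    glued      : Γ ≐ a₁ · Γ₁ ⊕ a₂ · Γ₂

data Telescopic (Γ : Pred ℕ 0ℓ) : Set₁ where
  naturals : Γ ≐ U → Telescopic Γ
  gluing   : ∀ {Γ₁ a₁ a₂} →
             IsGluing Γ a₁ Γ₁ a₂ U →
             Telescopic Γ₁ →
             (∀ {n} → IsMinimalGenerator Γ₁ n → a₁ * n < a₂) →
             Telescopic Γ

-- Γ is viewed inside ℤ: the integer a - x lies in Γ iff it is + b for some b ∈ Γ.
Ap : Pred ℕ 0ℓ → ℤ → Pred ℕ 0ℓ
Ap Γ x a = a ∈ Γ × ¬ (∃ λ b → b ∈ Γ × + a - x ≡ + b)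

-- Cardinality is expressed by a duplicate-free enumeration, since a bijection
-- Fin k ↔ ∃ P would also count the different proofs of P x for the same x.
_HasSize_ : Pred ℕ 0ℓ → ℕ → Set
P HasSize k =
  ∃ λ xs → Unique xs × length xs ≡ k × (∀ x → x ∈ˡ xs ⇔ x ∈ P)

IsMinimum : Pred ℕ 0ℓ → ℕ → Set
IsMinimum P m = m ∈ P × (∀ {k} → k ∈ P → m ≤ k)

-- IsE₂ Γ e says E(Γ,2) = e, where E(Γ,2) = min { #Ap(Γ,x) | x ∈ ℕ ∖ {0} }.
-- This minimum is known to be the constant in the eventual formula
-- δ²(a) = a + 1 - 2g + E(Γ,2) for the second Feng-Rao number, and is taken
-- here as the definition.
IsE₂ : Pred ℕ 0ℓ → ℕ → Set
IsE₂ Γ = IsMinimum (λ k → ∃ λ x → x ≢ 0 × Ap Γ (+ x) HasSize k)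

-- Let Γ = aΓ₁ + bℕ be a gluing.  Every integer is uniquely a u + b v with 0 ≤ v < a, and
-- it lies in Γ iff u ∈ Γ₁.  Splitting Ap(Γ, a u + b v) by the second coordinate of its
-- elements gives
--   #Ap(Γ, a u + b v) = v #Ap(Γ₁, u + b) + (a - v) #Ap(Γ₁, u).
-- With μ the least and M the greatest minimal generator of Γ₁, aμ and b play these roles
-- for Γ.  By induction the first summand is at least v μ (q - v + a) and the second at
-- least (a - v) μ (q - v), where q = ⌈(a u + b v) / b⌉, because b > a M; these add up to
-- a μ q.  Minimal generators are handled as irreducible elements, which belong to every
-- generating list.  Finally #Ap(Γ, n₁) ≤ n₁ since the elements of Ap(Γ, n₁) are pairwise
-- incongruent modulo n₁.

module Submission where

open import Defs
open import Algebra.Properties.AbelianGroup using (∙-cancelʳ)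
open import Data.Empty using (⊥; ⊥-elim)
open import Data.Fin.Base as Fin using (Fin; zero; suc; toℕ; fromℕ; fromℕ<)
  renaming (_<_ to _<ᶠ_)
import Data.Fin.Properties as Fin
open import Data.Integer.Base as ℤ using (ℤ; +_; -[1+_]; +[1+_])
import Data.Integer.Coprimality as ℤ using (coprime-divisor)
open import Data.Integer.DivMod
  using (_%ℕ_; _/ℕ_; n%ℕd<d; a≡a%ℕn+[a/ℕn]*n; div-pos-is-/ℕ; n<s[n/ℕd]*d)
import Data.Integer.Properties as ℤ
import Data.Integer.Tactic.RingSolver as ℤSolver
open import Data.List.Base
  using (List; []; _∷_; _++_; map; length; lookup; tabulate; allFin; upTo; cartesianProductWith)
open import Data.List.Membership.Propositional using () renaming (_∈_ to _∈ˡ_)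
open import Data.List.Membership.Propositional.Properties
open import Data.List.Membership.Setoid.Properties using (index-injective)
open import Data.List.Properties using (length-++; length-map; length-tabulate; length-upTo)
open import Data.List.Relation.Unary.All as All using ()
open import Data.List.Relation.Unary.AllPairs using ([]; _∷_)
open import Data.List.Relation.Unary.Any using (here; there; index)
open import Data.List.Relation.Unary.Unique.Propositional using (Unique)
import Data.List.Relation.Unary.Unique.Propositional.Properties as Unique
open import Data.Nat.Base hiding (_/_)
open import Data.Nat.Coprimality using (Coprime; gcd≡1⇒coprime; coprime-Bézout)
open import Data.Nat.Divisibility using (_∣_; divides; _∣0; ∣-refl; m∣m*n; >⇒∤)
open import Data.Nat.DivMod using (m%n<n; m≡m%n+[m/n]*n) renaming (_/_ to _/ⁿ_)
open import Data.Nat.GCD using (module Bézout)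
open import Data.Nat.Properties
import Data.Nat.Tactic.RingSolver as ℕSolver
open import Data.Product.Base using (∃; ∃₂; _×_; _,_; proj₁; proj₂)
open import Data.Rational.Unnormalised.Base using (_/_; ceiling)
open import Data.Sum.Base as Sum using (_⊎_; inj₁; inj₂)
open import Data.Unit.Base using (tt)
open import Function.Base using (_∘_; id; case_of_)
open import Function.Bundles using (_⇔_; mk⇔; Equivalence)
open import Level using (0ℓ)
open import Relation.Binary.Definitions using (tri<; tri≈; tri>)
open import Relation.Binary.PropositionalEquality
open import Relation.Nullary using (contradiction)
open import Relation.Unary using (Pred; _∈_; _⊆_; _≐_; _∪_; U)

open Equivalence using (to; from)

private
  variable
    Γ Δ P Q : Pred ℕ 0ℓ
    k l : ℕ

-- Cardinalities

lookup-injective : ∀ {A : Set} {xs : List A} → Unique xs →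
                   ∀ {i j} → lookup xs i ≡ lookup xs j → i ≡ j
lookup-injective (_ ∷ _) {zero} {zero} _ = refl
lookup-injective {xs = _ ∷ xs} (x∉ ∷ _) {zero} {suc j} eq =
  contradiction eq (All.lookup x∉ (∈-lookup j))
lookup-injective {xs = _ ∷ xs} (x∉ ∷ _) {suc i} {zero} eq =
  contradiction (sym eq) (All.lookup x∉ (∈-lookup i))
lookup-injective (_ ∷ xs!) {suc i} {suc j} eq = cong suc (lookup-injective xs! eq)

-- A pigeonhole principle. The map `f` may depend on the membership proof, so that both positions in
-- another list and residues can serve as its values.
length≤ : ∀ {A : Set} {xs : List A} {n} → Unique xs →
          (f : ∀ {x} → x ∈ˡ xs → Fin n) →
          (∀ {x y} (p : x ∈ˡ xs) (q : y ∈ˡ xs) → f p ≡ f q → x ≡ y) →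
          length xs ≤ n
length≤ {xs = xs} xs! f f-inj = Fin.injective⇒≤ {f = λ i → f (∈-lookup {xs = xs} i)}
  (λ {i} {j} → lookup-injective xs! ∘ f-inj (∈-lookup i) (∈-lookup j))

HasSize-resp-≐ : P ≐ Q → P HasSize k → Q HasSize k
HasSize-resp-≐ (P⊆Q , Q⊆P) (xs , xs! , len , mem) =
  xs , xs! , len , λ x → mk⇔ (P⊆Q ∘ to (mem x)) (from (mem x) ∘ Q⊆P)

-- Positions in `ys` are the pigeonholes. Taken with `P` equal to `Q`, this compares two
-- enumerations of one set.
HasSize-mono-⊆ : P ⊆ Q → P HasSize k → Q HasSize l → k ≤ l
HasSize-mono-⊆ P⊆Q (xs , xs! , refl , memˣ) (ys , _ , refl , memʸ) =
  length≤ xs! (index ∘ xs⊆ys) (λ p q → index-injective (setoid ℕ) (xs⊆ys p) (xs⊆ys q))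
  where
  xs⊆ys : ∀ {x} → x ∈ˡ xs → x ∈ˡ ys
  xs⊆ys {x} = from (memʸ x) ∘ P⊆Q ∘ to (memˣ x)

HasSize-∪ : (∀ {x} → x ∈ P → x ∈ Q → ⊥) → P HasSize k → Q HasSize l → P ∪ Q HasSize k + l
HasSize-∪ disjoint (xs , xs! , refl , memˣ) (ys , ys! , refl , memʸ) =
  xs ++ ys ,
  Unique.++⁺ xs! ys! (λ {x} (x∈xs , x∈ys) → disjoint (to (memˣ x) x∈xs) (to (memʸ x) x∈ys)) ,
  length-++ xs ,
  λ x → mk⇔ (Sum.map (to (memˣ x)) (to (memʸ x)) ∘ ∈-++⁻ xs)
            Sum.[ ∈-++⁺ˡ ∘ from (memˣ x) , ∈-++⁺ʳ xs ∘ from (memʸ x) ]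

Image : ∀ {r} → (Fin r → ℕ → ℕ) → Pred ℕ 0ℓ → Pred ℕ 0ℓ
Image f P x = ∃₂ λ i y → y ∈ P × x ≡ f i y

length-cartesianProductWith : ∀ {A B C : Set} (f : A → B → C) xs ys →
  length (cartesianProductWith f xs ys) ≡ length xs * length ys
length-cartesianProductWith f []       ys = refl
length-cartesianProductWith f (x ∷ xs) ys =
  trans (length-++ (map (f x) ys))
        (cong₂ _+_ (length-map (f x) ys) (length-cartesianProductWith f xs ys))

HasSize-Image : ∀ {r} (f : Fin r → ℕ → ℕ) → (∀ {i j y z} → f i y ≡ f j z → i ≡ j × y ≡ z) →
                P HasSize k → Image f P HasSize r * k
HasSize-Image {r = r} f f-inj (ys , ys! , refl , mem) =
  cartesianProductWith f (allFin r) ys ,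
  Unique.cartesianProductWith⁺ f f-inj (Unique.allFin⁺ r) ys! ,
  trans (length-cartesianProductWith f (allFin r) ys)
        (cong (λ n → n * length ys) (length-tabulate {n = r} id)) ,
  λ x → mk⇔ (λ x∈ → case ∈-cartesianProductWith⁻ f (allFin r) ys x∈ of λ where
              (i , y , _ , y∈ys , x≡) → i , y , to (mem y) y∈ys , x≡)
            (λ where (i , y , y∈P , refl) →
                       ∈-cartesianProductWith⁺ f (∈-allFin i) (from (mem y) y∈P))

-- Generating lists and irreducible elements

0∈⟨_⟩ : ∀ ns → 0 ∈ ⟨ ns ⟩
0∈⟨ [] ⟩     = refl
0∈⟨ n ∷ ns ⟩ = 0 , 0 , (0 , tt , sym (*-zeroʳ n)) , 0∈⟨ ns ⟩ , refl

⟨⟩-+-closed : ∀ ns {x y} → x ∈ ⟨ ns ⟩ → y ∈ ⟨ ns ⟩ → x + y ∈ ⟨ ns ⟩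
⟨⟩-+-closed []       refl refl = refl
⟨⟩-+-closed (n ∷ ns) (_ , x , (j , _ , refl) , x∈ , refl) (_ , y , (k , _ , refl) , y∈ , refl) =
  n * (j + k) , x + y , (j + k , tt , refl) , ⟨⟩-+-closed ns x∈ y∈ , distribute n j k x y
  where
  distribute : ∀ n j k x y → (n * j + x) + (n * k + y) ≡ n * (j + k) + (x + y)
  distribute = ℕSolver.solve-∀

⟨⟩-weaken : ∀ {n ns} → ⟨ ns ⟩ ⊆ ⟨ n ∷ ns ⟩
⟨⟩-weaken {n} x∈ = 0 , _ , (0 , tt , sym (*-zeroʳ n)) , x∈ , refl

multiple∈⟨⟩ : ∀ {n ns} k → n * k ∈ ⟨ n ∷ ns ⟩
multiple∈⟨⟩ {n} {ns} k = n * k , 0 , (k , tt , refl) , 0∈⟨ ns ⟩ , sym (+-identityʳ _)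

generator∈⟨⟩ : ∀ {n ns} → n ∈ˡ ns → n ∈ ⟨ ns ⟩
generator∈⟨⟩ {ns = n ∷ ns} (here refl) = subst ⟨ n ∷ ns ⟩ (*-identityʳ n) (multiple∈⟨⟩ {n} {ns} 1)
generator∈⟨⟩ {ns = n ∷ ns} (there p)   = ⟨⟩-weaken {n} {ns} (generator∈⟨⟩ p)

Irreducible : Pred ℕ 0ℓ → Pred ℕ 0ℓ
Irreducible Γ n = n ≢ 0 × (∀ {y z} → y ∈ Γ → z ∈ Γ → n ≡ y + z → y ≡ 0 ⊎ z ≡ 0)

irreducible-1 : Irreducible Γ 1
irreducible-1 = (λ ()) , λ {y} {z} _ _ → summand≡0 y z
  where
  summand≡0 : ∀ y z → 1 ≡ y + z → y ≡ 0 ⊎ z ≡ 0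
  summand≡0 zero    _       _  = inj₁ refl
  summand≡0 (suc _) zero    _  = inj₂ refl
  summand≡0 (suc y) (suc z) eq = contradiction (trans (suc-injective eq) (+-suc y z)) λ ()

-- If the head `m` is used, then `n` is `m` plus a remainder in `Γ`, and one of the two vanishes.
-- Asking for an inclusion in `Γ` rather than an equality lets the recursion pass to the tail.
irreducible⇒∈ : ∀ {n} ns → ⟨ ns ⟩ ⊆ Γ → Irreducible Γ n → n ∈ ⟨ ns ⟩ → n ∈ˡ ns
irreducible⇒∈ [] _ (n≢0 , _) 0≡n = contradiction (sym 0≡n) n≢0
irreducible⇒∈ (m ∷ ms) ⊆Γ irr (_ , z , (zero , _ , refl) , z∈ , refl) =
  there (irreducible⇒∈ ms (⊆Γ ∘ ⟨⟩-weaken {m} {ms}) irr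
    (subst ⟨ ms ⟩ (cong (_+ z) (sym (*-zeroʳ m))) z∈))
irreducible⇒∈ {n = n} (m ∷ ms) ⊆Γ irr@(_ , split) (_ , z , (suc k , _ , refl) , z∈ , refl)
  with split (⊆Γ (generator∈⟨⟩ {ns = m ∷ ms} (here refl)))
             (⊆Γ (m * k , z , (k , tt , refl) , z∈ , refl))
             (trans (cong (_+ z) (*-suc m k)) (+-assoc m (m * k) z))
-- A zero head contributes nothing, so `n` already comes from the tail.
... | inj₁ refl = there (irreducible⇒∈ ms (⊆Γ ∘ ⟨⟩-weaken {m} {ms}) irr z∈)
... | inj₂ rest≡0 = here (trans (cong (_+ z) (*-suc m k)) (trans (+-assoc m (m * k) z)
                      (trans (cong (_+_ m) rest≡0) (+-identityʳ m))))

record IsPresentation (Γ : Pred ℕ 0ℓ) (A : List ℕ) : Set where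
  field
    generates   : Γ ≐ ⟨ A ⟩
    irreducible : ∀ {n} → n ∈ˡ A → Irreducible Γ n

  generator∈ : ∀ {n} → n ∈ˡ A → n ∈ Γ
  generator∈ = proj₂ generates ∘ generator∈⟨⟩

  0∈ : 0 ∈ Γ
  0∈ = proj₂ generates 0∈⟨ A ⟩

  +-closed : ∀ {x y} → x ∈ Γ → y ∈ Γ → x + y ∈ Γ
  +-closed x∈ y∈ =
    proj₂ generates (⟨⟩-+-closed A (proj₁ generates x∈) (proj₁ generates y∈))

  *-closed : ∀ {x} k → x ∈ Γ → x * k ∈ Γ
  *-closed {x} zero    x∈ = subst Γ (sym (*-zeroʳ x)) 0∈
  *-closed {x} (suc k) x∈ = subst Γ (sym (*-suc x k)) (+-closed x∈ (*-closed k x∈))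

  -- If `A ∖ n` still generated `Γ`, the irreducible `n` would have to be one of its entries.
  isMinimalGeneratingSet : IsMinimalGeneratingSet Γ A
  isMinimalGeneratingSet = record
    { positive  = All.tabulate (≢-nonZero ∘ proj₁ ∘ irreducible)
    ; generates = generates
    ; minimal   = λ {n} n∈A Γ≐ → proj₂ (∈-filter⁻ _ {xs = A}
        (irreducible⇒∈ (A ∖ n) (proj₂ Γ≐) (irreducible n∈A) (proj₁ Γ≐ (generator∈ n∈A)))) refl
    }

  isMinimalGenerator : ∀ {n} → n ∈ˡ A → IsMinimalGenerator Γ n
  isMinimalGenerator n∈A = A , isMinimalGeneratingSet , n∈A

  irreducible∈ : ∀ {n} → n ∈ Γ → Irreducible Γ n → n ∈ˡ A
  irreducible∈ n∈Γ irr = irreducible⇒∈ A (proj₂ generates) irr (proj₁ generates n∈Γ)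

presentation-U : Γ ≐ U → IsPresentation Γ (1 ∷ [])
presentation-U (_ , ⊇) = record
  { generates   = (λ {x} _ → subst ⟨ 1 ∷ [] ⟩ (*-identityˡ x) (multiple∈⟨⟩ {1} {[]} x)) , λ _ → ⊇ tt
  ; irreducible = λ where (here refl) → irreducible-1
  }

-- Integers in the form a u + b v with 0 ≤ v < a

infix 4 _∈ᶻ_

-- This unfolds to the condition that is negated in `Ap`.
_∈ᶻ_ : ℤ → Pred ℕ 0ℓ → Set
x ∈ᶻ Γ = ∃ λ b → b ∈ Γ × x ≡ + b

pos-linear : ∀ a y b k → + (a * y + b * k) ≡ + a ℤ.* + y ℤ.+ + b ℤ.* + k
pos-linear a y b k = trans (ℤ.pos-+ (a * y) (b * k)) (cong₂ ℤ._+_ (ℤ.pos-* a y) (ℤ.pos-* b k))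

+-cancelʳ-<ᶻ : ∀ k {i j} → i ℤ.+ k ℤ.< j ℤ.+ k → i ℤ.< j
+-cancelʳ-<ᶻ k {i} {j} i+k<j+k =
  subst₂ ℤ._<_ (cancel i k) (cancel j k) (ℤ.+-monoˡ-< (ℤ.- k) i+k<j+k)
  where
  cancel : ∀ i k → (i ℤ.+ k) ℤ.- k ≡ i
  cancel = ℤSolver.solve-∀

module CoprimePair {a b} .{{_ : NonZero a}} (coprime : Coprime a b) where

  bézout : ∃₂ λ p q → ℤ.1ℤ ≡ + a ℤ.* p ℤ.+ + b ℤ.* q
  bézout with coprime-Bézout coprime
  ... | Bézout.+- p q eq = + p , ℤ.- + q , shift (+ a) (+ p) (+ b) (+ q)
    (trans (cong (ℤ._+_ ℤ.1ℤ) (sym (ℤ.pos-* q b))) (trans (cong +_ eq) (ℤ.pos-* p a)))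
    where
    rearrange : ∀ a p b q → (ℤ.1ℤ ℤ.+ q ℤ.* b) ℤ.+ b ℤ.* ℤ.- q ≡ ℤ.1ℤ
    rearrange = ℤSolver.solve-∀
    shift : ∀ a p b q → ℤ.1ℤ ℤ.+ q ℤ.* b ≡ p ℤ.* a → ℤ.1ℤ ≡ a ℤ.* p ℤ.+ b ℤ.* ℤ.- q
    shift a p b q eq = trans (sym (rearrange a p b q))
      (cong (λ t → t ℤ.+ b ℤ.* ℤ.- q) (trans eq (ℤ.*-comm p a)))
  ... | Bézout.-+ p q eq = ℤ.- + p , + q , shift (+ a) (+ p) (+ b) (+ q)
    (trans (cong (ℤ._+_ ℤ.1ℤ) (sym (ℤ.pos-* p a))) (trans (cong +_ eq) (ℤ.pos-* q b)))
    where
    rearrange : ∀ a p b q → a ℤ.* ℤ.- p ℤ.+ (ℤ.1ℤ ℤ.+ p ℤ.* a) ≡ ℤ.1ℤ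
    rearrange = ℤSolver.solve-∀
    shift : ∀ a p b q → ℤ.1ℤ ℤ.+ p ℤ.* a ≡ q ℤ.* b → ℤ.1ℤ ≡ a ℤ.* ℤ.- p ℤ.+ b ℤ.* q
    shift a p b q eq = trans (sym (rearrange a p b q))
      (cong (λ t → a ℤ.* ℤ.- p ℤ.+ t) (trans eq (ℤ.*-comm q b)))

  -- Multiply the Bézout identity by `x` and reduce the coefficient of `b` modulo `a`; the quotient
  -- `d` moves into the coefficient of `a` as `b d`.
  decompose : ∀ x → ∃₂ λ u v → v < a × x ≡ + a ℤ.* u ℤ.+ + b ℤ.* + v
  decompose x with p , q , eq ← bézout =
    x ℤ.* p ℤ.+ + b ℤ.* d , v , n%ℕd<d (x ℤ.* q) a , (begin
      x                                           ≡⟨ ℤ.*-identityʳ x ⟨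
      x ℤ.* ℤ.1ℤ                                  ≡⟨ cong (x ℤ.*_) eq ⟩
      x ℤ.* (+ a ℤ.* p ℤ.+ + b ℤ.* q)             ≡⟨ distribute x (+ a) p (+ b) q ⟩
      + a ℤ.* (x ℤ.* p) ℤ.+ + b ℤ.* (x ℤ.* q)     ≡⟨ cong (λ t → + a ℤ.* (x ℤ.* p) ℤ.+ + b ℤ.* t)
                                                          (a≡a%ℕn+[a/ℕn]*n (x ℤ.* q) a) ⟩
      + a ℤ.* (x ℤ.* p) ℤ.+ + b ℤ.* (+ v ℤ.+ d ℤ.* + a) ≡⟨ collect (+ a) (x ℤ.* p) (+ b) (+ v) d ⟩
      + a ℤ.* (x ℤ.* p ℤ.+ + b ℤ.* d) ℤ.+ + b ℤ.* + v   ∎)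
    where
    open ≡-Reasoning
    v = (x ℤ.* q) %ℕ a
    d = (x ℤ.* q) /ℕ a
    distribute : ∀ x a p b q → x ℤ.* (a ℤ.* p ℤ.+ b ℤ.* q) ≡ a ℤ.* (x ℤ.* p) ℤ.+ b ℤ.* (x ℤ.* q)
    distribute = ℤSolver.solve-∀
    collect : ∀ a s b v d → a ℤ.* s ℤ.+ b ℤ.* (v ℤ.+ d ℤ.* a) ≡ a ℤ.* (s ℤ.+ b ℤ.* d) ℤ.+ b ℤ.* v
    collect = ℤSolver.solve-∀

  -- The equation makes `a` divide `b (k - l)`, hence `k - l` by coprimality, and a multiple of `a`
  -- of absolute value below `a` is zero.
  decompose-unique : ∀ {x y k l} → k < a → l < a →
    + a ℤ.* x ℤ.+ + b ℤ.* + k ≡ + a ℤ.* y ℤ.+ + b ℤ.* + l → x ≡ y × k ≡ l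
  decompose-unique {x} {y} {k} {l} k<a l<a eq = x≡y , k≡l
    where
    isolate : ∀ a b x y k l → b ℤ.* (k ℤ.- l) ≡
      a ℤ.* (y ℤ.- x) ℤ.+ ((a ℤ.* x ℤ.+ b ℤ.* k) ℤ.- (a ℤ.* y ℤ.+ b ℤ.* l))
    isolate = ℤSolver.solve-∀
    b[k-l]≡a[y-x] : + b ℤ.* (+ k ℤ.- + l) ≡ + a ℤ.* (y ℤ.- x)
    b[k-l]≡a[y-x] = trans (isolate (+ a) (+ b) x y (+ k) (+ l))
      (trans (cong (λ t → + a ℤ.* (y ℤ.- x) ℤ.+ t) (ℤ.i≡j⇒i-j≡0 eq)) (ℤ.+-identityʳ _))
    a∣k-l : a ∣ ℤ.∣ + k ℤ.- + l ∣
    a∣k-l = ℤ.coprime-divisor (+ a) (+ b) (+ k ℤ.- + l) coprime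
      (subst (a ∣_) (sym (trans (cong ℤ.∣_∣ b[k-l]≡a[y-x]) (ℤ.abs-* (+ a) (y ℤ.- x))))
        (m∣m*n ℤ.∣ y ℤ.- x ∣))
    ∣k-l∣<a : ℤ.∣ + k ℤ.- + l ∣ < a
    ∣k-l∣<a = subst (λ t → ℤ.∣ t ∣ < a) (sym (ℤ.[+m]-[+n]≡m⊖n k l))
      (≤-<-trans (ℤ.∣m⊝n∣≤m⊔n k l) (⊔-lub k<a l<a))
    k≡l : k ≡ l
    k≡l with ℤ.∣ + k ℤ.- + l ∣ in ∣k-l∣≡ | a∣k-l | ∣k-l∣<a
    ... | zero  | _ | _ = ℤ.+-injective (ℤ.i-j≡0⇒i≡j (+ k) (+ l) (ℤ.∣i∣≡0⇒i≡0 ∣k-l∣≡))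
    ... | suc _ | a∣ | <a = contradiction a∣ (>⇒∤ <a)
    x≡y : x ≡ y
    x≡y = ℤ.*-cancelˡ-≡ (+ a) x y
      (∙-cancelʳ ℤ.+-0-abelianGroup (+ b ℤ.* + l) (+ a ℤ.* x) (+ a ℤ.* y)
      (trans (cong (λ t → + a ℤ.* x ℤ.+ + b ℤ.* + t) (sym k≡l)) eq))

-- Apéry sets of telescopic semigroups

-- The bound says s ≥ μ ⌈x / M⌉; it is stated for all integers x because the
-- quotient u in the decomposition of x may be negative.
Apéry : Pred ℕ 0ℓ → ℕ → ℕ → ℤ → Set
Apéry Γ μ M x = ∃ λ s → Ap Γ x HasSize s × (∀ t → + (M * t) ℤ.< x → μ * suc t ≤ s)

-- The generators are irreducible and so occur in every generating list. Membership of `μ` and `M`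
-- thus gives `n₁ ≤ μ` and `M ≤ nₘ` for the list in the theorem.
record IsTelescoped (Γ : Pred ℕ 0ℓ) (μ M : ℕ) : Set where
  field
    generators     : List ℕ
    isPresentation : IsPresentation Γ generators
    μ∈             : μ ∈ˡ generators
    M∈             : M ∈ˡ generators
    apéry          : ∀ x → Apéry Γ μ M x

  open IsPresentation isPresentation public

Ap-U : ∀ x → Apéry U 1 1 x
Ap-U (+ n) = n ,
  (upTo n , Unique.upTo⁺ n , length-upTo n , λ x → mk⇔ (below x ∘ ∈-upTo⁻) (∈-upTo⁺ ∘ above x)) ,
  λ where t (ℤ.+<+ t<n) → subst (_≤ n) (sym (*-identityˡ (suc t)))
                            (subst (_< n) (*-identityˡ t) t<n)
  where
  below : ∀ x → x < n → Ap U (+ n) x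
  below x x<n = tt , λ (b , _ , eq) → <⇒≱ x<n
    (ℤ.drop‿+≤+ (ℤ.0≤i-j⇒j≤i (subst (ℤ.0ℤ ℤ.≤_) (sym eq) (ℤ.+≤+ z≤n))))
  above : ∀ x → Ap U (+ n) x → x < n
  above x (_ , ∉) = ≰⇒> λ n≤x → ∉ (x ∸ n , tt , trans (ℤ.[+m]-[+n]≡m⊖n x n) (ℤ.⊖-≥ n≤x))
-- For negative `x` every `a - x` is a natural number, so the Apéry set is empty; no `t` satisfies
-- the premise of the bound.
Ap-U -[1+ n ] = 0 ,
  ([] , [] , refl , λ x → mk⇔ (λ ()) (λ (_ , ∉) → contradiction (x + suc n , tt , refl) ∉)) ,
  λ _ ()

Ap-resp-≐ : Γ ≐ Δ → ∀ x → Ap Γ x ≐ Ap Δ x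
Ap-resp-≐ (Γ⊆Δ , Δ⊆Γ) x =
  (λ (a∈ , ∉) → Γ⊆Δ a∈ , λ (b , b∈ , eq) → ∉ (b , Δ⊆Γ b∈ , eq)) ,
  (λ (a∈ , ∉) → Δ⊆Γ a∈ , λ (b , b∈ , eq) → ∉ (b , Γ⊆Δ b∈ , eq))

telescoped-U : Γ ≐ U → IsTelescoped Γ 1 1
telescoped-U (⊆ , ⊇) = record
  { generators = 1 ∷ []
  ; isPresentation = presentation-U (⊆ , ⊇)
  ; μ∈ = here refl
  ; M∈ = here refl
  ; apéry = λ x → case Ap-U x of λ (s , size , bound) →
      s , HasSize-resp-≐ (Ap-resp-≐ (⊇ , ⊆) x) size , bound
  }

-- The inductive step: gluing with the natural numbers

module Gluing {Γ Γ₁ a b μ M} (g : IsGluing Γ a Γ₁ b U) (T : IsTelescoped Γ₁ μ M)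
              (below-b : ∀ {n} → n ∈ˡ IsTelescoped.generators T → a * n < b) where

  open IsGluing g hiding (coprime)
  module T = IsTelescoped T

  a-b-coprime : Coprime a b
  a-b-coprime = gcd≡1⇒coprime (IsGluing.coprime g)

  -- Coprimality with 0 would force `b = 1`, which is irreducible and hence a minimal generator of
  -- `Γ₁`, contrary to the definition of a gluing.
  a≢0 : a ≢ 0
  a≢0 refl = a₂-notMin (T.isMinimalGenerator (T.irreducible∈ a₂∈Γ₁
    (subst (Irreducible Γ₁) (sym (a-b-coprime (b ∣0 , ∣-refl))) irreducible-1)))

  a≢1 : a ≢ 1
  a≢1 refl = a₁-notMin (IsPresentation.isMinimalGenerator (presentation-U (id , id)) (here refl))

  instance
    a-nonZero : NonZero a
    a-nonZero = ≢-nonZero a≢0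

  open CoprimePair {a} {b} a-b-coprime

  combine : ∀ {y} k → y ∈ Γ₁ → a * y + b * k ∈ Γ
  combine {y} k y∈ = proj₂ glued (a * y , b * k , (y , y∈ , refl) , (k , tt , refl) , refl)

  Splitting : ℕ → Set
  Splitting w = ∃₂ λ y k → y ∈ Γ₁ × w ≡ a * y + b * k

  split : ∀ {w} → w ∈ Γ → Splitting w
  split w∈ with _ , _ , (y , y∈ , refl) , (k , _ , refl) , refl ← proj₁ glued w∈ =
    y , k , y∈ , refl

  -- Because `b` lies in `Γ₁`, a multiple `q a` in the coefficient of `b` can be absorbed into the
  -- `Γ₁` part as `b q`.
  normalise : ∀ {w} → w ∈ Γ → ∃₂ λ y k → y ∈ Γ₁ × k < a × w ≡ a * y + b * k
  normalise w∈ with y , j , y∈ , refl ← split w∈ =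
    y + b * (j /ⁿ a) , j % a , T.+-closed y∈ (T.*-closed (j /ⁿ a) a₂∈Γ₁) , m%n<n j a ,
    trans (cong (λ t → a * y + b * t) (m≡m%n+[m/n]*n j a)) (rearrange a y b (j % a) (j /ⁿ a))
    where
    rearrange : ∀ a y b r q → a * y + b * (r + q * a) ≡ a * (y + b * q) + b * r
    rearrange = ℕSolver.solve-∀

  ∈ᶻ-combine : ∀ {u} k → u ∈ᶻ Γ₁ → + a ℤ.* u ℤ.+ + b ℤ.* + k ∈ᶻ Γ
  ∈ᶻ-combine k (y , y∈ , refl) = a * y + b * k , combine k y∈ , sym (pos-linear a y b k)

  -- The normal form of the element has its first coordinate in `Γ₁`, and uniqueness identifies that
  -- coordinate with `u`.
  ∈ᶻ-component : ∀ {u k} → k < a → + a ℤ.* u ℤ.+ + b ℤ.* + k ∈ᶻ Γ → u ∈ᶻ Γ₁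
  ∈ᶻ-component k<a (w , w∈ , eq) with y , l , y∈ , l<a , refl ← normalise w∈ =
    y , y∈ , proj₁ (decompose-unique k<a l<a (trans eq (pos-linear a y b l)))

  -- Once the element and its difference with `x` are both in normal form, their membership in `Γ`
  -- is decided by the first coordinates `y` and `y - u`.
  Ap-component : ∀ x u {y k j} → k < a → j < a →
    + (a * y + b * k) ℤ.- x ≡ + a ℤ.* (+ y ℤ.- u) ℤ.+ + b ℤ.* + j →
    a * y + b * k ∈ Ap Γ x ⇔ y ∈ Ap Γ₁ u
  Ap-component x u {y} {k} {j} k<a j<a eq = mk⇔
    (λ (w∈ , ∉) →
      let z , z∈ , y≡z = ∈ᶻ-component {+ y} k<a (_ , w∈ , sym (pos-linear a y b k))
      in subst Γ₁ (sym (ℤ.+-injective y≡z)) z∈ ,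
         λ y-u∈ → ∉ (subst (_∈ᶻ Γ) (sym eq) (∈ᶻ-combine j y-u∈)))
    (λ (y∈ , ∉) → combine k y∈ , λ w-x∈ → ∉ (∈ᶻ-component j<a (subst (_∈ᶻ Γ) eq w-x∈)))

  -- Counting an Apéry set by second coordinates

  layer : ∀ {r} → ℕ → Fin r → ℕ → ℕ
  layer v i y = a * y + b * (v + toℕ i)

  layer-injective : ∀ {r v} → v + r ≤ a → ∀ {i j : Fin r} {y z} →
                    layer v i y ≡ layer v j z → i ≡ j × y ≡ z
  layer-injective {r} {v} v+r≤a {i} {j} {y} {z} eq =
    case decompose-unique (bound i) (bound j)
           (trans (sym (pos-linear a y b (v + toℕ i)))
                  (trans (cong +_ eq) (pos-linear a z b (v + toℕ j))))
    of λ (y≡z , i≡j) → Fin.toℕ-injective (+-cancelˡ-≡ v _ _ i≡j) , ℤ.+-injective y≡z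
    where
    bound : ∀ (i : Fin r) → v + toℕ i < a
    bound i = <-≤-trans (+-monoʳ-< v (Fin.toℕ<n i)) v+r≤a

  module _ {u v r} (a≡v+r : a ≡ v + r) (x : ℤ) (x≡ : x ≡ + a ℤ.* u ℤ.+ + b ℤ.* + v) where

    v≤a : v ≤ a
    v≤a = subst (v ≤_) (sym a≡v+r) (m≤m+n v r)

    -- Here `k - v` is negative. Adding `a` turns it into `k + r`, which is below `a`, and the
    -- compensation lowers the first coordinate by `b`.
    Ap-low : ∀ {y k} → k < v → a * y + b * k ∈ Ap Γ x ⇔ y ∈ Ap Γ₁ (u ℤ.+ + b)
    Ap-low {y} {k} k<v = Ap-component x (u ℤ.+ + b) {j = k + r} (<-≤-trans k<v v≤a)
      (subst (k + r <_) (sym a≡v+r) (+-monoˡ-< r k<v))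
      (begin
        + (a * y + b * k) ℤ.- x ≡⟨ cong₂ ℤ._-_ (pos-linear a y b k) x≡ ⟩
        (+ a ℤ.* + y ℤ.+ + b ℤ.* + k) ℤ.- (+ a ℤ.* u ℤ.+ + b ℤ.* + v)
          ≡⟨ cong (λ t → (t ℤ.* + y ℤ.+ + b ℤ.* + k) ℤ.- (t ℤ.* u ℤ.+ + b ℤ.* + v)) a≡ᶻ ⟩
        ((+ v ℤ.+ + r) ℤ.* + y ℤ.+ + b ℤ.* + k) ℤ.- ((+ v ℤ.+ + r) ℤ.* u ℤ.+ + b ℤ.* + v)
          ≡⟨ rearrange (+ v) (+ r) (+ b) (+ y) u (+ k) ⟩
        (+ v ℤ.+ + r) ℤ.* (+ y ℤ.- (u ℤ.+ + b)) ℤ.+ + b ℤ.* (+ k ℤ.+ + r)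
          ≡⟨ cong₂ (λ s t → s ℤ.* (+ y ℤ.- (u ℤ.+ + b)) ℤ.+ + b ℤ.* t) a≡ᶻ (ℤ.pos-+ k r) ⟨
        + a ℤ.* (+ y ℤ.- (u ℤ.+ + b)) ℤ.+ + b ℤ.* + (k + r) ∎)
      where
      open ≡-Reasoning
      a≡ᶻ : + a ≡ + v ℤ.+ + r
      a≡ᶻ = trans (cong +_ a≡v+r) (ℤ.pos-+ v r)
      rearrange : ∀ v r b y u k →
        ((v ℤ.+ r) ℤ.* y ℤ.+ b ℤ.* k) ℤ.- ((v ℤ.+ r) ℤ.* u ℤ.+ b ℤ.* v)
        ≡ (v ℤ.+ r) ℤ.* (y ℤ.- (u ℤ.+ b)) ℤ.+ b ℤ.* (k ℤ.+ r)
      rearrange = ℤSolver.solve-∀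

    -- Subtracting `v` leaves the second coordinate `j` in range, so nothing is borrowed.
    Ap-high : ∀ {y j} → v + j < a → a * y + b * (v + j) ∈ Ap Γ x ⇔ y ∈ Ap Γ₁ u
    Ap-high {y} {j} v+j<a = Ap-component x u {j = j} v+j<a (≤-<-trans (m≤n+m j v) v+j<a)
      (begin
        + (a * y + b * (v + j)) ℤ.- x ≡⟨ cong₂ ℤ._-_ (pos-linear a y b (v + j)) x≡ ⟩
        (+ a ℤ.* + y ℤ.+ + b ℤ.* + (v + j)) ℤ.- (+ a ℤ.* u ℤ.+ + b ℤ.* + v)
          ≡⟨ cong (λ t → (+ a ℤ.* + y ℤ.+ + b ℤ.* t) ℤ.- (+ a ℤ.* u ℤ.+ + b ℤ.* + v)) (ℤ.pos-+ v j) ⟩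
        (+ a ℤ.* + y ℤ.+ + b ℤ.* (+ v ℤ.+ + j)) ℤ.- (+ a ℤ.* u ℤ.+ + b ℤ.* + v)
          ≡⟨ rearrange (+ a) (+ y) (+ b) (+ v) (+ j) u ⟩
        + a ℤ.* (+ y ℤ.- u) ℤ.+ + b ℤ.* + j ∎)
      where
      open ≡-Reasoning
      rearrange : ∀ a y b v j u →
        (a ℤ.* y ℤ.+ b ℤ.* (v ℤ.+ j)) ℤ.- (a ℤ.* u ℤ.+ b ℤ.* v) ≡ a ℤ.* (y ℤ.- u) ℤ.+ b ℤ.* j
      rearrange = ℤSolver.solve-∀

    low : Pred ℕ 0ℓ
    low = Image (layer {v} 0) (Ap Γ₁ (u ℤ.+ + b))

    high : Pred ℕ 0ℓ
    high = Image (layer {r} v) (Ap Γ₁ u)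

    high-bound : ∀ (i : Fin r) → v + toℕ i < a
    high-bound i = subst (v + toℕ i <_) (sym a≡v+r) (+-monoʳ-< v (Fin.toℕ<n i))

    low-high-disjoint : ∀ {w} → w ∈ low → w ∈ high → ⊥
    low-high-disjoint (i , y , _ , refl) (j , z , _ , eq) =
      <⇒≢ (<-≤-trans (Fin.toℕ<n i) (m≤m+n v (toℕ j)))
      (proj₂ (decompose-unique {+ y} {+ z} (<-≤-trans (Fin.toℕ<n i) v≤a) (high-bound j)
        (trans (sym (pos-linear a y b (toℕ i)))
               (trans (cong +_ eq) (pos-linear a z b (v + toℕ j))))))

    low∪high≐Ap : low ∪ high ≐ Ap Γ x
    low∪high≐Ap = Sum.[ low⊆ , high⊆ ] , ⊆low∪high
      where
      low⊆ : low ⊆ Ap Γ x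
      low⊆ (i , y , y∈ , refl) = from (Ap-low (Fin.toℕ<n i)) y∈
      high⊆ : high ⊆ Ap Γ x
      high⊆ (i , y , y∈ , refl) = from (Ap-high (high-bound i)) y∈
      ⊆low∪high : Ap Γ x ⊆ low ∪ high
      ⊆low∪high w∈@(w∈Γ , _) with y , k , _ , k<a , refl ← normalise w∈Γ with <-≤-connex k v
      ... | inj₁ k<v = inj₁ (fromℕ< k<v , y , to (Ap-low k<v) w∈ ,
                             cong (λ t → a * y + b * t) (sym (Fin.toℕ-fromℕ< k<v)))
      ... | inj₂ v≤k with j , refl ← m≤n⇒∃[o]m+o≡n v≤k =
        inj₂ (fromℕ< j<r , y , to (Ap-high k<a) w∈ ,
              cong (λ t → a * y + b * (v + t)) (sym (Fin.toℕ-fromℕ< j<r)))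
        where
        j<r : j < r
        j<r = +-cancelˡ-< v j r (subst (v + j <_) a≡v+r k<a)

    Ap-size : ∀ {s s′} → Ap Γ₁ (u ℤ.+ + b) HasSize s → Ap Γ₁ u HasSize s′ →
              Ap Γ x HasSize v * s + r * s′
    Ap-size size size′ = HasSize-resp-≐ low∪high≐Ap (HasSize-∪ low-high-disjoint
      (HasSize-Image (layer 0) (layer-injective v≤a) size)
      (HasSize-Image (layer v) (layer-injective (≤-reflexive (sym a≡v+r))) size′))

    -- The lower bound for a gluing

    -- The telescopic condition gives `a M < b`, so `a M n ≤ b n < a u′`, and `a` cancels.
    M-scale : ∀ n {u′} → + (b * n) ℤ.< + a ℤ.* u′ → + (M * n) ℤ.< u′
    M-scale n {u′} bn<au′ = ℤ.*-cancelˡ-<-nonNeg (+ a) (begin-strict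
      + a ℤ.* + (M * n) ≡⟨ ℤ.pos-* a (M * n) ⟨
      + (a * (M * n))   ≤⟨ ℤ.+≤+ (≤-trans (≤-reflexive (sym (*-assoc a M n)))
                                          (*-monoˡ-≤ n (<⇒≤ (below-b T.M∈)))) ⟩
      + (b * n)         <⟨ bn<au′ ⟩
      + a ℤ.* u′        ∎)
      where open ℤ.≤-Reasoning

    -- Adding `b r` to `b t < a u + b v` gives `b (t + r) < a (u + b)`, since `v + r = a`.
    low-threshold : ∀ t → + (b * t) ℤ.< x → + (M * (t + r)) ℤ.< u ℤ.+ + b
    low-threshold t bt<x = M-scale (t + r) (begin-strict
      + (b * (t + r))             ≡⟨ trans (cong +_ (*-distribˡ-+ b t r)) (ℤ.pos-+ (b * t) (b * r)) ⟩
      + (b * t) ℤ.+ + (b * r)     <⟨ ℤ.+-monoˡ-< (+ (b * r)) bt<x ⟩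
      x ℤ.+ + (b * r)             ≡⟨ cong₂ ℤ._+_ x≡ (ℤ.pos-* b r) ⟩
      (+ a ℤ.* u ℤ.+ + b ℤ.* + v) ℤ.+ + b ℤ.* + r ≡⟨ rearrange (+ a) u (+ b) (+ v) (+ r) ⟩
      + a ℤ.* u ℤ.+ (+ v ℤ.+ + r) ℤ.* + b
        ≡⟨ cong (λ t → + a ℤ.* u ℤ.+ t ℤ.* + b) (trans (cong +_ a≡v+r) (ℤ.pos-+ v r)) ⟨
      + a ℤ.* u ℤ.+ + a ℤ.* + b   ≡⟨ ℤ.*-distribˡ-+ (+ a) u (+ b) ⟨
      + a ℤ.* (u ℤ.+ + b)         ∎)
      where
      open ℤ.≤-Reasoning
      rearrange : ∀ a u b v r → (a ℤ.* u ℤ.+ b ℤ.* v) ℤ.+ b ℤ.* r ≡ a ℤ.* u ℤ.+ (v ℤ.+ r) ℤ.* b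
      rearrange = ℤSolver.solve-∀

    high-threshold : ∀ w → + (b * (v + w)) ℤ.< x → + (M * w) ℤ.< u
    high-threshold w b[v+w]<x = M-scale w (+-cancelʳ-<ᶻ (+ b ℤ.* + v) (begin-strict
      + (b * w) ℤ.+ + b ℤ.* + v   ≡⟨ trans (cong (λ t → + (b * w) ℤ.+ t) (sym (ℤ.pos-* b v)))
                                           (sym (ℤ.pos-+ (b * w) (b * v))) ⟩
      + (b * w + b * v)           ≡⟨ cong +_ (trans (+-comm (b * w) (b * v))
                                                    (sym (*-distribˡ-+ b v w))) ⟩
      + (b * (v + w))             <⟨ b[v+w]<x ⟩
      x                           ≡⟨ x≡ ⟩
      + a ℤ.* u ℤ.+ + b ℤ.* + v   ∎))
      where open ℤ.≤-Reasoning

    -- When t < v the second summand may vanish, but then the first one suffices.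
    Ap-bound : ∀ {s s′} →
      (∀ t → + (M * t) ℤ.< u ℤ.+ + b → μ * suc t ≤ s) →
      (∀ t → + (M * t) ℤ.< u → μ * suc t ≤ s′) →
      ∀ t → + (b * t) ℤ.< x → (a * μ) * suc t ≤ v * s + r * s′
    Ap-bound {s} {s′} s-bound s′-bound t bt<x with ≤-<-connex v t
    ... | inj₁ v≤t with w , refl ← m≤n⇒∃[o]m+o≡n v≤t = begin
      (a * μ) * suc (v + w)       ≡⟨ cong (λ a → (a * μ) * suc (v + w)) a≡v+r ⟩
      ((v + r) * μ) * suc (v + w) ≡⟨ rearrange 1 v r μ w ⟩
      v * (μ * suc (v + w + r)) + r * (μ * suc w)
        ≤⟨ +-mono-≤ (*-monoʳ-≤ v (s-bound (v + w + r) (low-threshold (v + w) bt<x)))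
                    (*-monoʳ-≤ r (s′-bound w (high-threshold w bt<x))) ⟩
      v * s + r * s′ ∎
      where
      open ≤-Reasoning
      -- The variable `c` is instantiated with 1, and `1 + n` computes to `suc n`.
      rearrange : ∀ c v r μ w →
        ((v + r) * μ) * (c + (v + w)) ≡ v * (μ * (c + (v + w + r))) + r * (μ * (c + w))
      rearrange = ℕSolver.solve-∀
    ... | inj₂ t<v with e , st+e≡v ← m≤n⇒∃[o]m+o≡n t<v = begin
      (a * μ) * suc t                       ≡⟨ cong (λ a → (a * μ) * suc t) a≡v+r ⟩
      -- With `v = t + 1 + e`, the term `μ r e` is exactly what completes the expression to the
      -- product `v μ (t + 1 + r)`.
      ((v + r) * μ) * suc t                 ≤⟨ m≤m+n _ (μ * r * e) ⟩
      ((v + r) * μ) * suc t + μ * r * e     ≡⟨ cong (λ v → ((v + r) * μ) * suc t + μ * r * e) st+e≡v ⟨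
      ((suc t + e + r) * μ) * suc t + μ * r * e ≡⟨ rearrange 1 t e r μ ⟩
      (suc t + e) * (μ * suc (t + r))       ≡⟨ cong (_* (μ * suc (t + r))) st+e≡v ⟩
      v * (μ * suc (t + r))                 ≤⟨ *-monoʳ-≤ v (s-bound (t + r) (low-threshold t bt<x)) ⟩
      v * s                                 ≤⟨ m≤m+n _ _ ⟩
      v * s + r * s′                        ∎
      where
      open ≤-Reasoning
      rearrange : ∀ c t e r μ →
        ((c + t + e + r) * μ) * (c + t) + μ * r * e ≡ (c + t + e) * (μ * (c + (t + r)))
      rearrange = ℕSolver.solve-∀

    apéry-step : Apéry Γ₁ μ M (u ℤ.+ + b) → Apéry Γ₁ μ M u → Apéry Γ (a * μ) b x
    apéry-step (s , size , s-bound) (s′ , size′ , s′-bound) =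
      v * s + r * s′ , Ap-size size size′ , Ap-bound s-bound s′-bound

  apéry : ∀ x → Apéry Γ (a * μ) b x
  apéry x = case decompose x of λ where
    (u , v , v<a , x≡) → case m≤n⇒∃[o]m+o≡n (<⇒≤ v<a) of λ where
      (r , v+r≡a) → apéry-step (sym v+r≡a) x x≡ (T.apéry (u ℤ.+ + b)) (T.apéry u)

  -- Irreducible generators of a gluing

  generators : List ℕ
  generators = b ∷ map (a *_) T.generators

  ⟨map⟩≐ : ∀ ns → a · ⟨ ns ⟩ ≐ ⟨ map (a *_) ns ⟩
  ⟨map⟩≐ [] =
    (λ where (_ , refl , refl) → sym (*-zeroʳ a)) , λ where refl → 0 , refl , sym (*-zeroʳ a)
  ⟨map⟩≐ (n ∷ ns) =
    (λ where
      (_ , (_ , z , (k , _ , refl) , z∈ , refl) , refl) →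
        (a * n) * k , a * z , (k , tt , refl) , proj₁ (⟨map⟩≐ ns) (z , z∈ , refl) , expand a n k z) ,
    (λ where
      (_ , _ , (k , _ , refl) , z′∈ , refl) → case proj₂ (⟨map⟩≐ ns) z′∈ of λ where
        (z , z∈ , refl) → n * k + z , (n * k , z , (k , tt , refl) , z∈ , refl) , sym (expand a n k z))
    where
    expand : ∀ a n k z → a * (n * k + z) ≡ (a * n) * k + a * z
    expand = ℕSolver.solve-∀

  generates : Γ ≐ ⟨ generators ⟩
  generates =
    (λ w∈ → case split w∈ of λ where
      (y , k , y∈ , refl) → b * k , a * y , (k , tt , refl) ,
        proj₁ (⟨map⟩≐ T.generators) (y , proj₁ T.generates y∈ , refl) , +-comm (a * y) (b * k)) ,
    (λ where
      (_ , _ , (k , _ , refl) , z∈ , refl) → case proj₂ (⟨map⟩≐ T.generators) z∈ of λ where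
        (y , y∈ , refl) → subst Γ (+-comm (a * y) (b * k)) (combine k (proj₂ T.generates y∈)))

  -- A summand that uses `b` leaves nothing for the other. If neither does, then `a` divides `b`,
  -- and coprimality gives the excluded case `a = 1`.
  b-irreducible : Irreducible Γ b
  b-irreducible =
    m<n⇒n≢0 (below-b T.M∈) , λ y∈ z∈ eq → decide (split y∈) (split z∈) eq
    where
    decide : ∀ {y z} → Splitting y → Splitting z → b ≡ y + z → y ≡ 0 ⊎ z ≡ 0
    remainder≡0 : ∀ p k {z} → b ≡ (a * p + b * suc k) + z → z ≡ 0
    remainder≡0 p k {z} eq = m+n≡0⇒n≡0 (a * p + b * k)
      (+-cancelˡ-≡ b _ 0 (trans (rearrange a p b k z) (trans (sym eq) (sym (+-identityʳ b)))))
      where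
      rearrange : ∀ a p b k z → b + ((a * p + b * k) + z) ≡ (a * p + b * suc k) + z
      rearrange = ℕSolver.solve-∀
    decide (p , zero , _ , refl) (q , zero , _ , refl) eq =
      contradiction (a-b-coprime (∣-refl , divides (p + q) (trans eq (collect a p q b)))) a≢1
      where
      collect : ∀ a p q b → (a * p + b * 0) + (a * q + b * 0) ≡ (p + q) * a
      collect = ℕSolver.solve-∀
    decide (p , suc k , _ , refl) (_ , _ , _ , refl) eq = inj₂ (remainder≡0 p k eq)
    decide (p , zero , _ , refl) (q , suc l , _ , refl) eq =
      inj₁ (remainder≡0 q l (trans eq (+-comm (a * p + b * 0) (a * q + b * suc l))))

  -- As `a n < b`, neither summand can use `b`. Both are then multiples of `a`, and cancelling `a`
  -- leaves a decomposition of `n` in `Γ₁`.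
  multiple-irreducible : ∀ {n} → n ∈ˡ T.generators → Irreducible Γ (a * n)
  multiple-irreducible {n} n∈ =
    (λ an≡0 → Sum.[ a≢0 , proj₁ (T.irreducible n∈) ] (m*n≡0⇒m≡0∨n≡0 a an≡0)) ,
    λ y∈ z∈ eq → decide (split y∈) (split z∈) eq
    where
    factor : ∀ a b p q → (a * p + b * 0) + (a * q + b * 0) ≡ a * (p + q)
    factor = ℕSolver.solve-∀
    vanish : ∀ {p} → p ≡ 0 → a * p + b * 0 ≡ 0
    vanish refl = cong₂ _+_ (*-zeroʳ a) (*-zeroʳ b)
    too-big : ∀ p k {z} → a * n ≢ (a * p + b * suc k) + z
    too-big p k {z} eq = <⇒≱ (below-b n∈) (begin
      b                     ≤⟨ m≤m*n b (suc k) ⟩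
      b * suc k             ≤⟨ m≤n+m (b * suc k) (a * p) ⟩
      a * p + b * suc k     ≤⟨ m≤m+n _ z ⟩
      a * p + b * suc k + z ≡⟨ eq ⟨
      a * n                 ∎)
      where open ≤-Reasoning
    decide : ∀ {y z} → Splitting y → Splitting z → a * n ≡ y + z → y ≡ 0 ⊎ z ≡ 0
    decide (p , suc k , _ , refl) _ eq = contradiction eq (too-big p k)
    decide {y} (_ , zero , _ , _) (q , suc l , _ , refl) eq =
      contradiction (trans eq (+-comm y (a * q + b * suc l))) (too-big q l)
    decide (p , zero , p∈ , refl) (q , zero , q∈ , refl) eq =
      Sum.map vanish vanish
        (proj₂ (T.irreducible n∈) p∈ q∈ (*-cancelˡ-≡ n (p + q) a (trans eq (factor a b p q))))

  isTelescoped : IsTelescoped Γ (a * μ) b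
  isTelescoped = record
    { generators     = generators
    ; isPresentation = record { generates = generates ; irreducible = generator-irreducible }
    ; μ∈             = there (∈-map⁺ (a *_) T.μ∈)
    ; M∈             = here refl
    ; apéry          = apéry
    }
    where
    generator-irreducible : ∀ {n} → n ∈ˡ generators → Irreducible Γ n
    generator-irreducible (here refl) = b-irreducible
    generator-irreducible (there n∈)
      with _ , m∈ , refl ← ∈-map⁻ (a *_) n∈ = multiple-irreducible m∈

-- The telescopic inequality speaks of minimal generators; it applies because the generators from
-- the induction hypothesis are irreducible, hence minimal.
telescoped : Telescopic Γ → ∃₂ (IsTelescoped Γ)
telescoped (naturals Γ≐U)    = 1 , 1 , telescoped-U Γ≐U
telescoped (gluing {a₁ = a} {b} g tel below-a₂) with μ , M , T ← telescoped tel =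
  a * μ , b , Gluing.isTelescoped g T (below-a₂ ∘ IsTelescoped.isMinimalGenerator T)

-- Elements of an Apéry set are pairwise incongruent: if y = x + j n with x ∈ Γ and
-- j > 0, then y - n = x + (j - 1) n ∈ Γ.
Ap-size≤ : ∀ ns {n s} .{{_ : NonZero n}} → n ∈ ⟨ ns ⟩ → Ap ⟨ ns ⟩ (+ n) HasSize s → s ≤ n
Ap-size≤ ns {n} n∈ (xs , xs! , refl , mem) =
  length≤ xs! (λ {x} _ → fromℕ< (m%n<n x n)) λ {x} {y} x∈ y∈ eq →
    let x%n≡y%n = Fin.fromℕ<-injective (x % n) (y % n) (m%n<n x n) (m%n<n y n) eq in
    case <-cmp (x /ⁿ n) (y /ⁿ n) of λ where
      (tri< x/n<y/n _ _) → ⊥-elim (incongruent x%n≡y%n x/n<y/n (to (mem x) x∈) (to (mem y) y∈))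
      (tri≈ _ x/n≡y/n _) → trans (m≡m%n+[m/n]*n x n)
        (trans (cong₂ (λ r q → r + q * n) x%n≡y%n x/n≡y/n) (sym (m≡m%n+[m/n]*n y n)))
      (tri> _ _ y/n<x/n) → ⊥-elim (incongruent (sym x%n≡y%n) y/n<x/n (to (mem y) y∈) (to (mem x) x∈))
  where
  multiple∈ : ∀ j → j * n ∈ ⟨ ns ⟩
  multiple∈ zero    = 0∈⟨ ns ⟩
  multiple∈ (suc j) = ⟨⟩-+-closed ns n∈ (multiple∈ j)

  incongruent : ∀ {x y} → x % n ≡ y % n → x /ⁿ n < y /ⁿ n →
                x ∈ Ap ⟨ ns ⟩ (+ n) → y ∈ Ap ⟨ ns ⟩ (+ n) → ⊥
  incongruent {x} {y} r≡ q< (x∈ , _) (_ , ∉) with j , eq ← m≤n⇒∃[o]m+o≡n q< =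
    ∉ (x + j * n , ⟨⟩-+-closed ns x∈ (multiple∈ j) , (begin
      + y ℤ.- + n                  ≡⟨ cong (λ t → + t ℤ.- + n) y≡ ⟩
      + (n + (x + j * n)) ℤ.- + n  ≡⟨ ℤ.[+m]-[+n]≡m⊖n (n + (x + j * n)) n ⟩
      (n + (x + j * n)) ℤ.⊖ n      ≡⟨ ℤ.⊖-≥ (m≤m+n n (x + j * n)) ⟩
      + (n + (x + j * n) ∸ n)      ≡⟨ cong +_ (m+n∸m≡n n (x + j * n)) ⟩
      + (x + j * n)                ∎))
    where
    open ≡-Reasoning
    regroup : ∀ r q j n → r + (suc q + j) * n ≡ n + ((r + q * n) + j * n)
    regroup = ℕSolver.solve-∀
    y≡ : y ≡ n + (x + j * n)
    y≡ = begin
      y                                        ≡⟨ m≡m%n+[m/n]*n y n ⟩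
      y % n + (y /ⁿ n) * n                     ≡⟨ cong₂ (λ r q → r + q * n) r≡ eq ⟨
      x % n + (suc (x /ⁿ n) + j) * n           ≡⟨ regroup (x % n) (x /ⁿ n) j n ⟩
      n + ((x % n + (x /ⁿ n) * n) + j * n)     ≡⟨ cong (λ t → n + (t + j * n)) (m≡m%n+[m/n]*n x n) ⟨
      n + (x + j * n)                          ∎

-- Ceilings and the passage to the given generators

-- The ceiling is the negated floor of `- z / N`. That floor is therefore `- (t + 1)`, and `- z` is
-- less than the floor plus one, times `N`, which is `- t N`.
ceiling-pred : ∀ z N .{{_ : NonZero N}} {t} → ⌈ + z / N ⌉ ≡ +[1+ t ] → N * t < z
ceiling-pred z N@(suc _) {t} eq = ℤ.drop‿+<+ (ℤ.neg-cancel-< (begin-strict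
  ℤ.- + z                        <⟨ n<s[n/ℕd]*d (ℤ.- + z) N ⟩
  ℤ.suc (ℤ.- + z /ℕ N) ℤ.* + N   ≡⟨ cong (λ q → ℤ.suc q ℤ.* + N) floor≡ ⟩
  ℤ.suc -[1+ t ] ℤ.* + N         ≡⟨ cong (ℤ._* + N) (suc-neg t) ⟩
  ℤ.- + t ℤ.* + N                ≡⟨ ℤ.neg-distribˡ-* (+ t) (+ N) ⟨
  ℤ.- (+ t ℤ.* + N)              ≡⟨ cong ℤ.-_ (trans (ℤ.*-comm (+ t) (+ N)) (sym (ℤ.pos-* N t))) ⟩
  ℤ.- + (N * t)                  ∎))
  where
  open ℤ.≤-Reasoning
  floor≡ : ℤ.- + z /ℕ N ≡ -[1+ t ]
  floor≡ = trans (sym (div-pos-is-/ℕ (ℤ.- + z) N)) (ℤ.neg-injective eq)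
  suc-neg : ∀ t → ℤ.suc -[1+ t ] ≡ ℤ.- + t
  suc-neg zero    = refl
  suc-neg (suc t) = refl

corollary16 : ∀ {m} (n : Fin (suc m) → ℕ) {{_ : ∀ {i} → NonZero (n i)}} →
    gcds (tabulate n) ≡ 1 →
    (∀ {i j} → i <ᶠ j → n i < n j) →
    let Γ = ⟨ tabulate n ⟩ in
    Telescopic Γ →
    (∀ (z : ℕ) → ∃ λ k → Ap Γ (+ z) HasSize k × + k ℤ.≥ + n zero ℤ.* ⌈ + z / n (fromℕ m) ⌉)
    × IsE₂ Γ (n zero)
corollary16 {m} n _ n-mono tel with μ , M , T ← telescoped tel =
  (λ z → let s , size , _ = T.apéry (+ z) in s , size , scaled-bound z _ refl) ,
  (n zero , ≢-nonZero⁻¹ (n zero) , minimum) ,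
  λ (x , x≢0 , size) → ≤-trans (size-bound x x≢0)
    (HasSize-mono-⊆ id (proj₁ (proj₂ (T.apéry (+ x)))) size)
  where
  module T = IsTelescoped T

  listed : ∀ {g} → g ∈ˡ T.generators → ∃ λ i → g ≡ n i
  listed g∈ = ∈-tabulate⁻ (irreducible⇒∈ (tabulate n) id (T.irreducible g∈) (T.generator∈ g∈))

  smallest : ∀ i → n zero ≤ n i
  smallest zero    = ≤-refl
  smallest (suc i) = <⇒≤ (n-mono z<s)

  largest : ∀ i → n i ≤ n (fromℕ m)
  largest i with m≤n⇒m<n∨m≡n (Fin.≤fromℕ i)
  ... | inj₁ i<m = <⇒≤ (n-mono i<m)
  ... | inj₂ i≡m = ≤-reflexive (cong n (Fin.toℕ-injective i≡m))

  n₀≤μ : n zero ≤ μ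
  n₀≤μ with i , refl ← listed T.μ∈ = smallest i

  M≤nₘ : M ≤ n (fromℕ m)
  M≤nₘ with i , refl ← listed T.M∈ = largest i

  -- The Apéry bound at `t = 0` reads `μ ≤ s`, and its premise `M * 0 < x` holds for positive `x`.
  size-bound : ∀ x → x ≢ 0 → n zero ≤ proj₁ (T.apéry (+ x))
  size-bound x x≢0 = ≤-trans n₀≤μ (≤-trans (≤-reflexive (sym (*-identityʳ μ)))
    (proj₂ (proj₂ (T.apéry (+ x))) 0 (ℤ.+<+ (≤-<-trans (≤-reflexive (*-zeroʳ M)) (n≢0⇒n>0 x≢0)))))

  -- The minimum is attained at `n₁`: incongruence modulo `n₁` bounds the size from above,
  -- `size-bound` from below.
  minimum : Ap ⟨ tabulate n ⟩ (+ n zero) HasSize n zero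
  minimum = subst (Ap ⟨ tabulate n ⟩ (+ n zero) HasSize_)
    (≤-antisym (Ap-size≤ (tabulate n) (generator∈⟨⟩ {ns = tabulate n} (here refl)) size)
               (size-bound (n zero) (≢-nonZero⁻¹ (n zero))))
    size
    where size = proj₁ (proj₂ (T.apéry (+ n zero)))

  -- The ceiling is generalised to `c` to allow a case distinction on its sign. For `c = t + 1` the
  -- Apéry bound applies at `t`, because `M t ≤ nₘ t < z`.
  scaled-bound : ∀ z c → ⌈ + z / n (fromℕ m) ⌉ ≡ c → + n zero ℤ.* c ℤ.≤ + proj₁ (T.apéry (+ z))
  scaled-bound z (+ zero) _ = ℤ.≤-trans (ℤ.≤-reflexive (ℤ.*-zeroʳ (+ n zero))) (ℤ.+≤+ z≤n)
  scaled-bound z -[1+ _ ] _ = ℤ.≤-trans (ℤ.*-monoˡ-≤-nonNeg (+ n zero) ℤ.-≤+)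
    (ℤ.≤-trans (ℤ.≤-reflexive (ℤ.*-zeroʳ (+ n zero))) (ℤ.+≤+ z≤n))
  scaled-bound z +[1+ t ] eq = ℤ.≤-trans (ℤ.≤-reflexive (sym (ℤ.pos-* (n zero) (suc t))))
    (ℤ.+≤+ (≤-trans (*-monoˡ-≤ (suc t) n₀≤μ) (proj₂ (proj₂ (T.apéry (+ z))) t
      (ℤ.+<+ (≤-<-trans (*-monoˡ-≤ t M≤nₘ) (ceiling-pred z (n (fromℕ m)) eq))))))
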